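{- Suppose $(S,\to,\twoheadrightarrow,\hookrightarrow)$ is a two-acyclic factorization system that obeys the image condition. The map $x\mapsto(T(x),T(x)^\perp)$ is an isomorphism from the transitive closure of $\rightsquigarrow$ on $S$ to the cover-determined forcing preorder on $\operatorname{Ji}^c(\operatorname{Pairs}(\to))$. This map induces an isomorphism from the poset of $\rightsquigarrow$-downsets under containment to the lattice $\operatorname{Con}^{cc}(\operatorname{Pairs}(\to))$.
   Context: For a binary relation $\to$ on a set $S$ and $X\subseteq S$, put $X^\perp=\{y\in S: x\not\to y\ \forall x\in X\}$ and ${}^\perp X=\{y\in S: y\not\to x\ \forall x\in X\}$. A maximal orthogonal pair is a pair $(X,Y)$ of subsets of $S$ with $Y=X^\perp$ and $X={}^\perp Y$. $\operatorname{Pairs}(\to)$ is the complete lattice of maximal orthogonal pairs, partially ordered by containment of first components. For a reflexive relation $\to$ on $S$, $\operatorname{Fact}(\to)=(\twoheadrightarrow,\hookrightarrow)$, where $x\twoheadrightarrow y$ iff for all $z$, $y\to z$ implies $x\to z$, and $x\hookrightarrow y$ iff for all $z$, $z\to x$ implies $z\to y$. For preorders $\twoheadrightarrow,\hookrightarrow$ on $S$, $\operatorname{Mult}(\twoheadrightarrow,\hookrightarrow)$ is the relation relating $x$ to $z$ iff there is $y\in S$ with $x\twoheadrightarrow y\hookrightarrow z$. A factorization system is a tuple $(S,\to,\twoheadrightarrow,\hookrightarrow)$ ($S$ possibly infinite) with $\to$ reflexive, $\operatorname{Fact}(\to)=(\twoheadrightarrow,\hookrightarrow)$ and $\operatorname{Mult}(\twoheadrightarrow,\hookrightarrow)=\to$.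 It is two-acyclic if $x\twoheadrightarrow y\twoheadrightarrow x$ implies $x=y$, $x\hookrightarrow y\hookrightarrow x$ implies $x=y$, and $x\twoheadrightarrow y\hookrightarrow x$ implies $x=y$. Convention: $x\twoheadrightarrow y$ or $x\hookrightarrow y$ is read as "$x$ is greater than or equal to $y$"; thus $x$ is $\twoheadrightarrow$-minimal in $A\ni x$ if there is no $x'\in A\setminus\{x\}$ with $x\twoheadrightarrow x'$, and $\hookrightarrow$-maximal in $A$ if there is no $x'\in A\setminus\{x\}$ with $x'\hookrightarrow x$. For $y\in S$, $T(y)=\{x'\in S: y\twoheadrightarrow x'\}$, $T_*(y)=T(y)\setminus\{y\}$, and $F(y)=\{x'\in S: x'\hookrightarrow y\}$. The relation $\rightsquigarrow$ on $S$: $x\rightsquigarrow y$ iff either $x$ is $\twoheadrightarrow$-minimal in $F(y)$ or $x$ is $\hookrightarrow$-maximal in $T(y)$. A $\rightsquigarrow$-downset is a subset $D\subseteq S$ such that $x\in D$ and $x\rightsquigarrow y$ imply $y\in D$. For $x\to z$, an image of $x\to z$ is a $\twoheadrightarrow$-minimal element of $\{y\in S: x\twoheadrightarrow y\hookrightarrow z\}$, and a co-image is a $\hookrightarrow$-maximal element of this set. The image condition: for all $x,z\in S$ with $x\to z$ there is at least one image and at least one co-image of $x\to z$. An element $j$ of a complete lattice $L$ is completely join-irreducible if $j=\bigvee X$ implies $j\in X$ for all $X\subseteq L$; $\operatorname{Ji}^cL$ is the set of these. The completely join-irreducible elements of $\operatorname{Pairs}(\to)$ are exactly the pairs $(T(x),T(x)^\perp)$,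 $x\in S$, and the unique element covered by $(T(x),T(x)^\perp)$ is $(T_*(x),T_*(x)^\perp)$. A congruence on a complete lattice is complete if it respects arbitrary nonempty meets and joins. A congruence $\Theta$ is cover-determined if, whenever $x\le y$ and $u\equiv v\bmod\Theta$ for all covers $u\lessdot v$ with $x\le u\lessdot v\le y$, then $x\equiv y\bmod\Theta$. $\Theta$ contracts a cover $a\lessdot b$ if $a\equiv b\bmod\Theta$. $\operatorname{Con}^{cc}(L)$ is the set of complete cover-determined congruences of $L$ under refinement order (finer is smaller); it is a complete lattice. The cover-determined forcing preorder on $\operatorname{Ji}^c(\operatorname{Pairs}(\to))$: $(T(x),T(x)^\perp)$ forces $(T(y),T(y)^\perp)$ iff every complete cover-determined congruence contracting $(T_*(x),T_*(x)^\perp)\lessdot(T(x),T(x)^\perp)$ also contracts $(T_*(y),T_*(y)^\perp)\lessdot(T(y),T(y)^\perp)$. The first isomorphism means a bijection such that $x$ is related to $y$ by the transitive closure of $\rightsquigarrow$ iff $(T(x),T(x)^\perp)$ forces $(T(y),T(y)^\perp)$. The induced map takes a downset $D$ to the complete cover-determined congruence for which $D$ is exactly the set of $x\in S$ such that $(T_*(x),T_*(x)^\perp)\lessdot(T(x),T(x)^\perp)$ is contracted. -}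

module Defs where

open import Axiom.ExcludedMiddle using (ExcludedMiddle)
open import Data.Bool.Base using (Bool; if_then_else_)
open import Data.Empty using (⊥-elim)
open import Data.Product.Base using (∃; _×_; _,_; proj₁; proj₂)
open import Function.Base using (_on_)
open import Level using (_⊔_; suc; Lift; lift)
open import Relation.Binary.Bundles using (Poset)
open import Relation.Binary.Core using (Rel; _⇒_; _⇔_)
open import Relation.Binary.PropositionalEquality using (_≡_; _≢_; refl)
open import Relation.Binary.Structures using (IsEquivalence; IsPartialOrder)
open import Relation.Nullary using (¬_; yes; no)
open import Relation.Unary using (Pred; _∈_; _∉_; _⊆_; _≐_; ⋂)

------------------------------------------------------------------------
-- Complete lattices

-- Joins and meets are taken over families indexed by types in Set ι.  The
-- subsets of the carrier are the ranges of such families.  The lattice Pairs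
-- below lives in Set (suc ℓ) and has ι = ℓ; under excluded middle it is in
-- bijection, up to _≈_, with a type in Set ℓ (represent subsets of S by maps
-- S → Bool), so every subset of it is then the range of such a family.

record CompleteLattice c ℓ₁ ℓ₂ ι : Set (suc (c ⊔ ℓ₁ ⊔ ℓ₂ ⊔ ι)) where
  field
    poset : Poset c ℓ₁ ℓ₂

  open Poset poset public using (Carrier; _≈_; _≤_)

  field
    ⋁       : {I : Set ι} → (I → Carrier) → Carrier
    ⋁-upper : {I : Set ι} (f : I → Carrier) → ∀ i → f i ≤ ⋁ f
    ⋁-least : {I : Set ι} (f : I → Carrier) → ∀ {u} → (∀ i → f i ≤ u) → ⋁ f ≤ u
    ⋀       : {I : Set ι} → (I → Carrier) → Carrier
    ⋀-lower : {I : Set ι} (f : I → Carrier) → ∀ i → ⋀ f ≤ f i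
    ⋀-great : {I : Set ι} (f : I → Carrier) → ∀ {l} → (∀ i → l ≤ f i) → l ≤ ⋀ f

  choose : Carrier → Carrier → Lift ι Bool → Carrier
  choose x y (lift b) = if b then x else y

  infixr 6 _∨_
  infixr 7 _∧_
  infix  4 _<_ _⋖_

  _∨_ : Carrier → Carrier → Carrier
  x ∨ y = ⋁ (choose x y)

  _∧_ : Carrier → Carrier → Carrier
  x ∧ y = ⋀ (choose x y)

  _<_ : Rel Carrier (ℓ₁ ⊔ ℓ₂)
  x < y = x ≤ y × ¬ (x ≈ y)

  _⋖_ : Rel Carrier (c ⊔ ℓ₁ ⊔ ℓ₂)
  x ⋖ y = x < y × ¬ ∃ λ z → x < z × z < y

module _ {c ℓ₁ ℓ₂ ι} (L : CompleteLattice c ℓ₁ ℓ₂ ι) where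
  open CompleteLattice L

  CompletelyJoinIrreducible : Pred Carrier (c ⊔ ℓ₁ ⊔ suc ι)
  CompletelyJoinIrreducible j =
    {I : Set ι} (f : I → Carrier) → j ≈ ⋁ f → ∃ λ i → j ≈ f i

  Jiᶜ : Set (c ⊔ ℓ₁ ⊔ suc ι)
  Jiᶜ = ∃ CompletelyJoinIrreducible

  record IsCongruence {t} (Θ : Rel Carrier t) : Set (c ⊔ ℓ₁ ⊔ t) where
    field
      isEquivalence : IsEquivalence Θ
      respects-≈    : _≈_ ⇒ Θ
      ∨-cong        : ∀ {x x′ y y′} → Θ x x′ → Θ y y′ → Θ (x ∨ y) (x′ ∨ y′)
      ∧-cong        : ∀ {x x′ y y′} → Θ x x′ → Θ y y′ → Θ (x ∧ y) (x′ ∧ y′)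

  -- The argument of type I says that the family is nonempty.
  record IsComplete {t} (Θ : Rel Carrier t) : Set (c ⊔ t ⊔ suc ι) where
    field
      ⋁-cong : {I : Set ι} → I → (f g : I → Carrier) →
               (∀ i → Θ (f i) (g i)) → Θ (⋁ f) (⋁ g)
      ⋀-cong : {I : Set ι} → I → (f g : I → Carrier) →
               (∀ i → Θ (f i) (g i)) → Θ (⋀ f) (⋀ g)

  CoverDetermined : ∀ {t} → Rel Carrier t → Set (c ⊔ ℓ₁ ⊔ ℓ₂ ⊔ t)
  CoverDetermined Θ = ∀ {x y} → x ≤ y →
    (∀ {u v} → u ⋖ v → x ≤ u → v ≤ y → Θ u v) → Θ x y

  -- Under excluded middle the level t is immaterial, as every relation is
  -- equivalent to one valued in Set t.
  record Conᶜᶜ t : Set (c ⊔ ℓ₁ ⊔ ℓ₂ ⊔ suc ι ⊔ suc t) where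
    field
      Θ               : Rel Carrier t
      isCongruence    : IsCongruence Θ
      isComplete      : IsComplete Θ
      coverDetermined : CoverDetermined Θ

module _ {c ℓ₁ ℓ₂ ι} {L : CompleteLattice c ℓ₁ ℓ₂ ι} where
  open CompleteLattice L

  infix 4 _≈ᶜ_ _≤ᶜ_

  _≈ᶜ_ : ∀ {t} → Rel (Conᶜᶜ L t) (c ⊔ t)
  _≈ᶜ_ = _⇔_ on Conᶜᶜ.Θ

  -- Refinement: the finer congruence is the smaller one.
  _≤ᶜ_ : ∀ {t} → Rel (Conᶜᶜ L t) (c ⊔ t)
  Φ ≤ᶜ Ψ = Conᶜᶜ.Θ Φ ⇒ Conᶜᶜ.Θ Ψ

  Contracts : ∀ {t} → Conᶜᶜ L t → (a b : Carrier) → a ⋖ b → Set t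
  Contracts Φ a b _ = Conᶜᶜ.Θ Φ a b

  _≈ʲ_ : Rel (Jiᶜ L) ℓ₁
  _≈ʲ_ = _≈_ on proj₁

  -- A completely join-irreducible element covers exactly one element, so a and
  -- b are determined up to _≈_; for Pairs, see T⋆⋖T and T⋆-unique.
  Forces : ∀ t → Rel (Jiᶜ L) (c ⊔ ℓ₁ ⊔ ℓ₂ ⊔ suc ι ⊔ suc t)
  Forces t (j , _) (k , _) = (Φ : Conᶜᶜ L t) →
    ∀ {a b} (a⋖j : a ⋖ j) (b⋖k : b ⋖ k) →
    Contracts Φ a j a⋖j → Contracts Φ b k b⋖k

------------------------------------------------------------------------
-- Maximal orthogonal pairs

module Orthogonality {ℓ} {S : Set ℓ} (_⟶_ : Rel S ℓ) where

  infix 9 _^⊥ ⊥^_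

  _^⊥ : Pred S ℓ → Pred S ℓ
  (X ^⊥) y = ∀ {x} → x ∈ X → ¬ (x ⟶ y)

  ⊥^_ : Pred S ℓ → Pred S ℓ
  (⊥^ Y) x = ∀ {y} → y ∈ Y → ¬ (x ⟶ y)

  record MaximalOrthogonalPair : Set (suc ℓ) where
    field
      X    : Pred S ℓ
      Y    : Pred S ℓ
      Y≐X⊥ : Y ≐ X ^⊥
      X≐⊥Y : X ≐ ⊥^ Y

  open MaximalOrthogonalPair

  private
    snd-antitone : ∀ P Q → X P ⊆ X Q → Y Q ⊆ Y P
    snd-antitone P Q P⊆Q y∈ =
      proj₂ (Y≐X⊥ P) λ x∈ → proj₁ (Y≐X⊥ Q) y∈ (P⊆Q x∈)

    fst-antitone : ∀ P Q → Y Q ⊆ Y P → X P ⊆ X Q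
    fst-antitone P Q Q⊆P x∈ =
      proj₂ (X≐⊥Y Q) λ y∈ → proj₁ (X≐⊥Y P) x∈ (Q⊆P y∈)

  pairsPoset : Poset (suc ℓ) ℓ ℓ
  pairsPoset = record
    { Carrier = MaximalOrthogonalPair
    ; _≈_     = λ P Q → X P ≐ X Q × Y P ≐ Y Q
    ; _≤_     = λ P Q → X P ⊆ X Q
    ; isPartialOrder = record
      { isPreorder = record
        { isEquivalence = record
          { refl  = ((λ p → p) , (λ p → p)) , ((λ p → p) , (λ p → p))
          ; sym   = λ { ((a , b) , (c , d)) → (b , a) , (d , c) }
          ; trans = λ { ((a , b) , (c , d)) ((a′ , b′) , (c′ , d′)) →
              ((λ p → a′ (a p)) , (λ p → b (b′ p))) ,
              ((λ p → c′ (c p)) , (λ p → d (d′ p))) }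
          }
        ; reflexive = λ e → proj₁ (proj₁ e)
        ; trans     = λ f g p → g (f p)
        }
      ; antisym = λ {P} {Q} f g →
          (f , g) , (snd-antitone Q P g , snd-antitone P Q f)
      }
    }

  -- The join has second component ⋂ Yᵢ, the meet has first component ⋂ Xᵢ.
  Pairs : CompleteLattice (suc ℓ) ℓ ℓ ℓ
  Pairs = record
    { poset   = pairsPoset
    ; ⋁       = λ {I} f → record
        { X    = ⊥^ (⋂ I λ i → Y (f i))
        ; Y    = ⋂ I λ i → Y (f i)
        ; Y≐X⊥ = (λ y∈ x∈ → x∈ y∈)
               , (λ y∈ i → proj₂ (Y≐X⊥ (f i)) λ x∈ →
                    y∈ λ y′∈ → proj₁ (X≐⊥Y (f i)) x∈ (y′∈ i))
        ; X≐⊥Y = (λ x∈ {y} → x∈ {y}) , (λ x∈ {y} → x∈ {y})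
        }
    ; ⋁-upper = λ f i x∈ y∈ → proj₁ (X≐⊥Y (f i)) x∈ (y∈ i)
    ; ⋁-least = λ f {u} h x∈ → proj₂ (X≐⊥Y u) λ y∈ →
        x∈ λ i → snd-antitone (f i) u (h i) y∈
    ; ⋀       = λ {I} f → record
        { X    = ⋂ I λ i → X (f i)
        ; Y    = (⋂ I λ i → X (f i)) ^⊥
        ; Y≐X⊥ = (λ y∈ {x} → y∈ {x}) , (λ y∈ {x} → y∈ {x})
        ; X≐⊥Y = (λ x∈ y∈ → y∈ x∈)
               , (λ x∈ i → proj₂ (X≐⊥Y (f i)) λ y∈ →
                    x∈ λ x′∈ → proj₁ (Y≐X⊥ (f i)) y∈ (x′∈ i))
        }
    ; ⋀-lower = λ f i x∈ → x∈ i
    ; ⋀-great = λ f h x∈ i → h i x∈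
    }

------------------------------------------------------------------------
-- Factorization systems

Fact : ∀ {ℓ} {S : Set ℓ} → Rel S ℓ → Rel S ℓ × Rel S ℓ
Fact _⟶_ = (λ x y → ∀ z → y ⟶ z → x ⟶ z)
         , (λ x y → ∀ z → z ⟶ x → z ⟶ y)

Mult : ∀ {ℓ} {S : Set ℓ} → Rel S ℓ → Rel S ℓ → Rel S ℓ
Mult _↠_ _↪_ x z = ∃ λ y → x ↠ y × y ↪ z

record FactorizationSystem ℓ : Set (suc ℓ) where
  infix 4 _⟶_ _↠_ _↪_
  field
    S     : Set ℓ
    _⟶_   : Rel S ℓ
    _↠_   : Rel S ℓ
    _↪_   : Rel S ℓ
    ⟶-refl : ∀ {x} → x ⟶ x
    fact-↠ : proj₁ (Fact _⟶_) ⇔ _↠_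
    fact-↪ : proj₂ (Fact _⟶_) ⇔ _↪_
    mult   : Mult _↠_ _↪_ ⇔ _⟶_

-- In both definitions x ≽ y reads "x is greater than or equal to y".

IsMinimal : ∀ {ℓ} {S : Set ℓ} → Rel S ℓ → Pred S ℓ → Pred S ℓ
IsMinimal _≽_ A x = x ∈ A × ¬ ∃ λ x′ → x′ ∈ A × x′ ≢ x × x ≽ x′

IsMaximal : ∀ {ℓ} {S : Set ℓ} → Rel S ℓ → Pred S ℓ → Pred S ℓ
IsMaximal _≽_ A x = x ∈ A × ¬ ∃ λ x′ → x′ ∈ A × x′ ≢ x × x′ ≽ x

module _ {ℓ} (𝓕 : FactorizationSystem ℓ) where
  open FactorizationSystem 𝓕

  record TwoAcyclic : Set ℓ where
    field
      ↠↠-acyclic : ∀ {x y} → x ↠ y → y ↠ x → x ≡ y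
      ↪↪-acyclic : ∀ {x y} → x ↪ y → y ↪ x → x ≡ y
      ↠↪-acyclic : ∀ {x y} → x ↠ y → y ↪ x → x ≡ y

  T : S → Pred S ℓ
  T y x = y ↠ x

  T⋆ : S → Pred S ℓ
  T⋆ y x = x ∈ T y × x ≢ y

  F : S → Pred S ℓ
  F y x = x ↪ y

  data _↝_ (x y : S) : Set ℓ where
    minimal : IsMinimal _↠_ (F y) x → x ↝ y
    maximal : IsMaximal _↪_ (T y) x → x ↝ y

  Between : S → S → Pred S ℓ
  Between x z y = x ↠ y × y ↪ z

  IsImage : S → S → Pred S ℓ
  IsImage x z = IsMinimal _↠_ (Between x z)

  IsCoimage : S → S → Pred S ℓ
  IsCoimage x z = IsMaximal _↪_ (Between x z)

  ImageCondition : Set ℓ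
  ImageCondition = ∀ {x z} → x ⟶ z → ∃ (IsImage x z) × ∃ (IsCoimage x z)

  record Downset : Set (suc ℓ) where
    field
      members : Pred S ℓ
      closed  : ∀ {x y} → x ∈ members → x ↝ y → y ∈ members

  infix 4 _≈ᵈ_ _≤ᵈ_

  _≈ᵈ_ : Rel Downset ℓ
  _≈ᵈ_ = _≐_ on Downset.members

  _≤ᵈ_ : Rel Downset ℓ
  D ≤ᵈ E = Downset.members D ⊆ Downset.members E

-- The mathematics is classical, so excluded middle is an explicit parameter.
-- It is already needed for T(x) = ⊥(T(x)^⊥), that is, for (T(x), T(x)^⊥) to be
-- a maximal orthogonal pair.

module TPairs {ℓ} (lem : ExcludedMiddle ℓ)
              (𝓕 : FactorizationSystem ℓ) (acyclic : TwoAcyclic 𝓕) where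
  open FactorizationSystem 𝓕
  open TwoAcyclic acyclic
  open Orthogonality _⟶_ public
  open CompleteLattice Pairs

  private
    ↠-refl : ∀ {x} → x ↠ x
    ↠-refl = proj₁ fact-↠ λ _ p → p

    ↠-∘-⟶ : ∀ {x y z} → x ↠ y → y ⟶ z → x ⟶ z
    ↠-∘-⟶ x↠y = proj₂ fact-↠ x↠y _

    ⊥T⊥⊆T : ∀ x → ⊥^ (T 𝓕 x ^⊥) ⊆ T 𝓕 x
    ⊥T⊥⊆T x {y} y∈ = proj₁ fact-↠ helper
      where
      helper : ∀ z → y ⟶ z → x ⟶ z
      helper z y⟶z with lem {x ⟶ z}
      ... | yes x⟶z = x⟶z
      ... | no  x↛z = ⊥-elim
              (y∈ (λ x↠x′ x′⟶z → x↛z (↠-∘-⟶ x↠x′ x′⟶z)) y⟶z)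

    x∈T⋆⊥ : ∀ x → x ∈ T⋆ 𝓕 x ^⊥
    x∈T⋆⊥ x (x↠x′ , x′≢x) x′⟶x with proj₂ mult x′⟶x
    ... | w , x′↠w , w↪x with ↠↪-acyclic
            (proj₁ fact-↠ λ _ p → ↠-∘-⟶ x↠x′ (↠-∘-⟶ x′↠w p)) w↪x
    ... | refl = x′≢x (↠↠-acyclic x′↠w x↠x′)

    X-closed : ∀ (P : Carrier) {x y} → x ↠ y →
               x ∈ MaximalOrthogonalPair.X P → y ∈ MaximalOrthogonalPair.X P
    X-closed P x↠y x∈ = proj₂ X≐⊥Y λ z∈ y⟶z →
      proj₁ X≐⊥Y x∈ z∈ (↠-∘-⟶ x↠y y⟶z)
      where open MaximalOrthogonalPair P

  TPair : S → MaximalOrthogonalPair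
  TPair x = record
    { X    = T 𝓕 x
    ; Y    = T 𝓕 x ^⊥
    ; Y≐X⊥ = (λ y∈ {x} → y∈ {x}) , (λ y∈ {x} → y∈ {x})
    ; X≐⊥Y = (λ x∈ y∈ → y∈ x∈) , ⊥T⊥⊆T x
    }

  T⋆Pair : S → MaximalOrthogonalPair
  T⋆Pair x = record
    { X    = T⋆ 𝓕 x
    ; Y    = T⋆ 𝓕 x ^⊥
    ; Y≐X⊥ = (λ y∈ {x} → y∈ {x}) , (λ y∈ {x} → y∈ {x})
    ; X≐⊥Y = (λ x∈ y∈ → y∈ x∈)
           , (λ y∈ → ⊥T⊥⊆T x (λ z∈ → y∈ λ { (x↠x′ , _) → z∈ x↠x′ })
                   , λ { refl → y∈ (x∈T⋆⊥ x) ⟶-refl })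
    }

  private
    antisym : ∀ {P Q} → P ≤ Q → Q ≤ P → P ≈ Q
    antisym {P} {Q} = Poset.antisym pairsPoset {P} {Q}

    ≤T⋆ : ∀ x P → P ≤ TPair x → x ∉ MaximalOrthogonalPair.X P → P ≤ T⋆Pair x
    ≤T⋆ x P P≤T x∉ y∈ = P≤T y∈ , λ { refl → x∉ y∈ }

  T⋆⋖T : ∀ x → T⋆Pair x ⋖ TPair x
  T⋆⋖T x = (proj₁ , λ { ((_ , T⊆T⋆) , _) → proj₂ (T⊆T⋆ ↠-refl) refl }) ,
    λ { (P , (T⋆≤P , T⋆≉P) , (P≤T , P≉T)) →
        T⋆≉P (antisym {T⋆Pair x} {P} T⋆≤P (≤T⋆ x P P≤T λ x∈ →
          P≉T (antisym {P} {TPair x} P≤T λ x↠y → X-closed P x↠y x∈))) }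

  T⋆-unique : ∀ x {P} → P ⋖ TPair x → P ≈ T⋆Pair x
  T⋆-unique x {P} ((P≤T , P≉T) , none) with lem {P ≈ T⋆Pair x}
  ... | yes P≈T⋆ = P≈T⋆
  ... | no  P≉T⋆ = ⊥-elim (none (T⋆Pair x ,
          (≤T⋆ x P P≤T (λ x∈ →
             P≉T (antisym {P} {TPair x} P≤T λ x↠y → X-closed P x↠y x∈)) , P≉T⋆) ,
          proj₁ (T⋆⋖T x)))

  TPair-irreducible : ∀ x → CompletelyJoinIrreducible Pairs (TPair x)
  TPair-irreducible x {I} f T≈⋁ with lem {∃ λ i → x ∈ MaximalOrthogonalPair.X (f i)}
  ... | yes (i , x∈) = i , antisym {TPair x} {f i}
          (λ x↠y → X-closed (f i) x↠y x∈)
          (λ y∈ → proj₂ (proj₁ T≈⋁) (⋁-upper f i y∈))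
  ... | no  x∉ = ⊥-elim (proj₂ (⋁f≤T⋆ (proj₁ (proj₁ T≈⋁) ↠-refl)) refl)
    where
    ⋁f≤T⋆ : ⋁ f ≤ T⋆Pair x
    ⋁f≤T⋆ = ⋁-least f {T⋆Pair x} λ i → ≤T⋆ x (f i)
      (λ y∈ → proj₂ (proj₁ T≈⋁) (⋁-upper f i y∈)) (λ x∈ → x∉ (i , x∈))

  TJi : S → Jiᶜ Pairs
  TJi x = TPair x , TPair-irreducible x

{-# OPTIONS --safe #-}

-- Write C for the complement of a ↝-downset D.  The congruence attached to D
-- identifies P and Q when their first components agree on C.  The image
-- condition says that an arrow x ⟶ y with y ∈ C (or x ∈ C) factors through an
-- image (or co-image) lying in C, so first components agree on C if and only if
-- second components do; the former description respects meets, the latter joins.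
--
-- Conversely, in a cover u ⋖ v there is c with c ∈ X v and c ∈ Y u, and then
-- v ≤ T(c) ∨ u while T⋆(c) ≤ u; hence a congruence contracts u ⋖ v as soon as it
-- contracts T⋆(c) ⋖ T(c), and a cover-determined congruence is the one
-- attached to the set of x for which it contracts T⋆(x) ⋖ T(x).

module Submission where

open import Defs
open import Axiom.DoubleNegationElimination using (em⇒dne)
open import Axiom.ExcludedMiddle using (ExcludedMiddle)
open import Data.Bool.Base using (true; false)
open import Data.Product.Base using (Σ-syntax; ∃; _×_; _,_; proj₁; proj₂)
open import Function.Bundles using (_⇔_; mk⇔)
open import Level using (lift)
open import Relation.Binary.Bundles using (Poset)
open import Relation.Binary.Construct.Closure.Transitive using (TransClosure; [_]; _∷_; _∷ʳ_)
open import Relation.Binary.Core using (Rel)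
open import Relation.Binary.Morphism.Structures using (IsOrderIsomorphism)
open import Relation.Binary.PropositionalEquality using (_≡_; refl; sym)
open import Relation.Binary.Structures using (IsEquivalence)
open import Relation.Nullary using (¬_)
open import Relation.Unary using (_∈_; _∉_; _⊆_)

-- Binary joins and meets, and transfer of contractions.

module LatticeProperties {c ℓ₁ ℓ₂ ι} (L : CompleteLattice c ℓ₁ ℓ₂ ι) where
  open CompleteLattice L
  open Poset poset using (antisym; trans) renaming (refl to ≤-refl)

  x≤x∨y : ∀ x y → x ≤ x ∨ y
  x≤x∨y x y = ⋁-upper (choose x y) (lift true)

  y≤x∨y : ∀ x y → y ≤ x ∨ y
  y≤x∨y x y = ⋁-upper (choose x y) (lift false)

  ∨-least : ∀ {x y z} → x ≤ z → y ≤ z → x ∨ y ≤ z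
  ∨-least {x} {y} x≤z y≤z = ⋁-least (choose x y) λ
    { (lift true) → x≤z ; (lift false) → y≤z }

  x∧y≤x : ∀ x y → x ∧ y ≤ x
  x∧y≤x x y = ⋀-lower (choose x y) (lift true)

  x∧y≤y : ∀ x y → x ∧ y ≤ y
  x∧y≤y x y = ⋀-lower (choose x y) (lift false)

  ∧-greatest : ∀ {x y z} → z ≤ x → z ≤ y → z ≤ x ∧ y
  ∧-greatest {x} {y} z≤x z≤y = ⋀-great (choose x y) λ
    { (lift true) → z≤x ; (lift false) → z≤y }

  -- The polynomial t ↦ (j ∧ (t ∨ a)) ∨ k sends p to k and q to j.
  congruence-transfer : ∀ {t} {Θ : Rel Carrier t} → IsCongruence L Θ →
    ∀ {p q a k j} → p ≤ a → j ≤ q ∨ a → j ∧ a ≤ k → k ≤ j → Θ p q → Θ k j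
  congruence-transfer isC {p} {q} {a} {k} {j} p≤a j≤q∨a j∧a≤k k≤j Θpq =
    Θ.trans (respects-≈ k≈fp) (Θ.trans
      (∨-cong (∧-cong Θ.refl (∨-cong Θpq Θ.refl)) Θ.refl) (respects-≈ fq≈j))
    where
    open IsCongruence isC
    module Θ = IsEquivalence isEquivalence

    k≈fp : k ≈ (j ∧ (p ∨ a)) ∨ k
    k≈fp = antisym (y≤x∨y _ k)
      (∨-least (trans (∧-greatest (x∧y≤x j _)
        (trans (x∧y≤y j _) (∨-least p≤a ≤-refl))) j∧a≤k) ≤-refl)

    fq≈j : (j ∧ (q ∨ a)) ∨ k ≈ j
    fq≈j = antisym (∨-least (x∧y≤x j _) k≤j)
      (trans (∧-greatest ≤-refl j≤q∨a) (x≤x∨y _ k))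

-- Composition and acyclicity in factorization systems.

module FactorizationProperties {ℓ} (𝓕 : FactorizationSystem ℓ) where
  open FactorizationSystem 𝓕

  ↠-refl : ∀ {x} → x ↠ x
  ↠-refl = proj₁ fact-↠ λ _ p → p

  ↪-refl : ∀ {x} → x ↪ x
  ↪-refl = proj₁ fact-↪ λ _ p → p

  ↠-∘-⟶ : ∀ {x y z} → x ↠ y → y ⟶ z → x ⟶ z
  ↠-∘-⟶ x↠y = proj₂ fact-↠ x↠y _

  ⟶-∘-↪ : ∀ {x y z} → x ⟶ y → y ↪ z → x ⟶ z
  ⟶-∘-↪ x⟶y y↪z = proj₂ fact-↪ y↪z _ x⟶y

  ↠-trans : ∀ {x y z} → x ↠ y → y ↠ z → x ↠ z
  ↠-trans x↠y y↠z = proj₁ fact-↠ λ _ p → ↠-∘-⟶ x↠y (↠-∘-⟶ y↠z p)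

  ↪-trans : ∀ {x y z} → x ↪ y → y ↪ z → x ↪ z
  ↪-trans x↪y y↪z = proj₁ fact-↪ λ _ p → ⟶-∘-↪ (⟶-∘-↪ p x↪y) y↪z

  ↠⇒⟶ : ∀ {x y} → x ↠ y → x ⟶ y
  ↠⇒⟶ x↠y = ↠-∘-⟶ x↠y ⟶-refl

  ↪⇒⟶ : ∀ {x y} → x ↪ y → x ⟶ y
  ↪⇒⟶ = ⟶-∘-↪ ⟶-refl

  -- A competitor in `F y` that `m` reaches by `↠` is also reached from `x`, so it already competes
  -- in `Between x y`.
  image⇒↝ : ∀ {x y m} → IsImage 𝓕 x y m → _↝_ 𝓕 m y
  image⇒↝ ((x↠m , m↪y) , min) = minimal (m↪y ,
    λ { (m′ , m′↪y , m′≢m , m↠m′) →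
        min (m′ , (↠-trans x↠m m↠m′ , m′↪y) , m′≢m , m↠m′) })

  coimage⇒↝ : ∀ {x y m} → IsCoimage 𝓕 x y m → _↝_ 𝓕 m x
  coimage⇒↝ ((x↠m , m↪y) , max) = maximal (x↠m ,
    λ { (m′ , x↠m′ , m′≢m , m↪m′) →
        max (m′ , (x↠m′ , ↪-trans m↪m′ m↪y) , m′≢m , m↪m′) })

  module _ (acyclic : TwoAcyclic 𝓕) where
    open TwoAcyclic acyclic

    -- Factoring `y ⟶ x` through `w` gives `x ↠ w ↪ x`; mixed acyclicity collapses `w` to `x`,
    -- leaving a `↠`-cycle.
    ↠⟶-acyclic : ∀ {x y} → x ↠ y → y ⟶ x → x ≡ y
    ↠⟶-acyclic x↠y y⟶x with proj₂ mult y⟶x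
    ... | w , y↠w , w↪x with ↠↪-acyclic (↠-trans x↠y y↠w) w↪x
    ... | refl = ↠↠-acyclic x↠y y↠w

    ⟶↪-acyclic : ∀ {x y} → x ⟶ y → y ↪ x → x ≡ y
    ⟶↪-acyclic x⟶y y↪x with proj₂ mult x⟶y
    ... | w , x↠w , w↪y with ↠↪-acyclic x↠w (↪-trans w↪y y↪x)
    ... | refl = ↪↪-acyclic w↪y y↪x

    -- This makes the transitive closure of `↝` a preorder, as forcing is.
    ↝-refl : ∀ {x} → _↝_ 𝓕 x x
    ↝-refl = minimal (↪-refl , λ { (_ , x′↪x , x′≢x , x↠x′) → x′≢x (sym (↠↪-acyclic x↠x′ x′↪x)) })

-- Irreducible elements and covers in the lattice of pairs.

module PairsProperties {ℓ} (lem : ExcludedMiddle ℓ)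
                       (𝓕 : FactorizationSystem ℓ) (acyclic : TwoAcyclic 𝓕) where
  open FactorizationSystem 𝓕
  open FactorizationProperties 𝓕 public
  open TPairs lem 𝓕 acyclic
  open MaximalOrthogonalPair
  open CompleteLattice Pairs
  open LatticeProperties Pairs

  dne : ∀ {A : Set ℓ} → ¬ ¬ A → A
  dne = em⇒dne lem

  ≤-antisym : ∀ P Q → X P ⊆ X Q → X Q ⊆ X P → P ≈ Q
  ≤-antisym P Q = Poset.antisym pairsPoset {P} {Q}

  X∩Y⇒↛ : ∀ P {x y} → x ∈ X P → y ∈ Y P → ¬ (x ⟶ y)
  X∩Y⇒↛ P x∈ y∈ = proj₁ (X≐⊥Y P) x∈ y∈

  X-closed : ∀ P {x y} → x ↠ y → x ∈ X P → y ∈ X P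
  X-closed P x↠y x∈ = proj₂ (X≐⊥Y P) λ z∈ y⟶z → X∩Y⇒↛ P x∈ z∈ (↠-∘-⟶ x↠y y⟶z)

  Y-closed : ∀ P {x y} → x ↪ y → y ∈ Y P → x ∈ Y P
  Y-closed P x↪y y∈ = proj₂ (Y≐X⊥ P) λ z∈ z⟶x → X∩Y⇒↛ P z∈ y∈ (⟶-∘-↪ z⟶x x↪y)

  TPair≤ : ∀ P {x} → x ∈ X P → TPair x ≤ P
  TPair≤ P x∈ x↠y = X-closed P x↠y x∈

  ∉X⇒⟶Y : ∀ P {x} → x ∉ X P → ∃ λ y → y ∈ Y P × x ⟶ y
  ∉X⇒⟶Y P x∉ = dne λ none → x∉ (proj₂ (X≐⊥Y P) λ y∈ x⟶y → none (_ , y∈ , x⟶y))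

  ≰⇒∃ : ∀ P Q → ¬ (P ≤ Q) → ∃ λ x → x ∈ X P × x ∉ X Q
  ≰⇒∃ P Q P≰Q = dne λ none → P≰Q λ x∈ → dne λ x∉ → none (_ , x∈ , x∉)

  -- The dual of `TPair`: the second component is the principal set `F y`, and avoiding all of it
  -- amounts to having no arrow to `y`.
  MPair : S → MaximalOrthogonalPair
  MPair y = record
    { X    = λ x → ¬ (x ⟶ y)
    ; Y    = F 𝓕 y
    ; Y≐X⊥ = (λ z↪y x↛y x⟶z → x↛y (⟶-∘-↪ x⟶z z↪y))
           , (λ z∈ → proj₁ fact-↪ λ _ w⟶z → dne λ w↛y → z∈ w↛y w⟶z)
    ; X≐⊥Y = (λ x↛y z↪y x⟶z → x↛y (⟶-∘-↪ x⟶z z↪y))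
           , (λ x∈ x⟶y → x∈ ↪-refl x⟶y)
    }

  T⋆≤M : ∀ x → T⋆Pair x ≤ MPair x
  T⋆≤M x (x↠z , z≢x) z⟶x = z≢x (sym (↠⟶-acyclic acyclic x↠z z⟶x))

  T∧≤T⋆ : ∀ {y} P → y ∉ X P → TPair y ∧ P ≤ T⋆Pair y
  T∧≤T⋆ {y} P y∉ z∈ = x∧y≤x (TPair y) P z∈ , λ { refl → y∉ (x∧y≤y (TPair y) P z∈) }

  -- T(c) ∨ P covers (T(c) ∨ P) ∧ M(c) when c ∈ Y P.
  T∨∧M⋖T∨ : ∀ {c} P → c ∈ Y P → (TPair c ∨ P) ∧ MPair c ⋖ TPair c ∨ P
  T∨∧M⋖T∨ {c} P c∈YP =
    (x∧y≤x v (MPair c) , λ { ((_ , v≤u) , _) →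
      x∧y≤y v (MPair c) (v≤u c∈v) ⟶-refl }) ,
    λ { (w , (u≤w , u≉w) , (w≤v , w≉v)) →
      u≉w (≤-antisym u w u≤w (∧-greatest {v} {MPair c} {w} w≤v (w≤M w u≤w w≤v w≉v))) }
    where
    v = TPair c ∨ P
    u = v ∧ MPair c

    c∈v : c ∈ X v
    c∈v = x≤x∨y (TPair c) P ↠-refl

    P≤u : P ≤ u
    P≤u = ∧-greatest {v} {MPair c} {P} (y≤x∨y (TPair c) P) (λ x∈ → X∩Y⇒↛ P x∈ c∈YP)

    w≤M : ∀ w → u ≤ w → w ≤ v → ¬ (w ≈ v) → w ≤ MPair c
    w≤M w u≤w w≤v w≉v with ∉X⇒⟶Y w (λ c∈w → w≉v (≤-antisym w v w≤v
      (∨-least {TPair c} {P} {w} (TPair≤ w c∈w) (λ x∈ → u≤w (P≤u x∈)))))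
    ... | y , y∈ , c⟶y with proj₂ mult c⟶y
    -- If `a` had no arrow to `c`, it would lie in `X u`, hence in `X w`, against `a ↪ y` with
    -- `y ∈ Y w`. So `a ⟶ c`, acyclicity gives `a ≡ c`, and `c ↪ y` keeps `X w` from reaching `c`.
    ... | a , c↠a , a↪y with ↠⟶-acyclic acyclic c↠a (dne λ a↛c →
            X∩Y⇒↛ w (u≤w (∧-greatest {v} {MPair c} {TPair a}
              (TPair≤ v (X-closed v c↠a c∈v)) (TPair≤ (MPair c) a↛c) ↠-refl)) y∈ (↪⇒⟶ a↪y))
    ... | refl = λ x∈ x⟶c → X∩Y⇒↛ w x∈ y∈ (⟶-∘-↪ x⟶c a↪y)

  -- `v ∧ MPair c` lies above `u` and strictly below `v`, since it omits `c`. The cover pushes it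
  -- down to `u`, and it bounds `T⋆Pair c`.
  ⋖⇒T⋆≤ : ∀ {u v c} → u ⋖ v → c ∈ X v → c ∈ Y u → T⋆Pair c ≤ u
  ⋖⇒T⋆≤ {u} {v} {c} ((u≤v , _) , none) c∈v c∈Yu z∈ =
    v∧M≤u (∧-greatest {v} {MPair c} {T⋆Pair c} (λ z∈ → TPair≤ v c∈v (proj₁ z∈)) (T⋆≤M c) z∈)
    where
    v∧M≤u : v ∧ MPair c ≤ u
    v∧M≤u = dne λ v∧M≰u → none (v ∧ MPair c ,
      (∧-greatest {v} {MPair c} {u} u≤v (λ x∈ → X∩Y⇒↛ u x∈ c∈Yu) ,
        λ { ((_ , ge) , _) → v∧M≰u ge }) ,
      (x∧y≤x v (MPair c) , λ { ((_ , v≤) , _) → x∧y≤y v (MPair c) (v≤ c∈v) ⟶-refl }))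

  -- `TPair c ∨ u` is strictly above `u`, because `c ∈ Y u` excludes `c` from `X u`; the cover
  -- leaves no room for it below `v`.
  ⋖⇒≤T∨ : ∀ {u v c} → u ⋖ v → c ∈ X v → c ∈ Y u → v ≤ TPair c ∨ u
  ⋖⇒≤T∨ {u} {v} {c} ((u≤v , _) , none) c∈v c∈Yu = dne λ v≰ → none (TPair c ∨ u ,
    (y≤x∨y (TPair c) u , λ { ((_ , ge) , _) →
      X∩Y⇒↛ u (ge (x≤x∨y (TPair c) u ↠-refl)) c∈Yu ⟶-refl }) ,
    (∨-least {TPair c} {u} {v} (TPair≤ v c∈v) u≤v , λ { ((_ , v≤) , _) → v≰ v≤ }))

  TPair-injective : ∀ {x y} → TPair x ≈ TPair y → x ≡ y
  TPair-injective ((x⊆y , y⊆x) , _) =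
    TwoAcyclic.↠↠-acyclic acyclic (y⊆x ↠-refl) (x⊆y ↠-refl)

  -- Any pair is the join of the `TPair x` over `x` in its first component; irreducibility selects
  -- one of them.
  TPair-exhausts : ∀ j → CompletelyJoinIrreducible Pairs j → ∃ λ x → TPair x ≈ j
  TPair-exhausts j irr with irr {∃ (_∈ X j)} (λ i → TPair (proj₁ i))
    (≤-antisym j (⋁ family)
      (λ x∈ → ⋁-upper family (_ , x∈) ↠-refl)
      (⋁-least family {j} λ i → TPair≤ j (proj₂ i)))
    where
    family : ∃ (_∈ X j) → Carrier
    family i = TPair (proj₁ i)
  ... | (x , _) , e = x , Poset.Eq.sym pairsPoset {j} {TPair x} e

  -- What a cover-determined congruence contracts.

  module Contraction (Φ : Conᶜᶜ Pairs ℓ) where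
    open Conᶜᶜ Φ
    open IsCongruence isCongruence
    module Θ = IsEquivalence isEquivalence

    -- `A` acts as a separator: missing `y`, it meets `TPair y` inside `T⋆Pair y`, whereas `Q ∨ A`
    -- contains all of `TPair y`.
    contracts-T : ∀ {P Q} A {y} → P ≤ A → y ∉ X A → y ∈ X (Q ∨ A) →
                  Θ P Q → Θ (T⋆Pair y) (TPair y)
    contracts-T {P} {Q} A {y} P≤A y∉A y∈ =
      congruence-transfer isCongruence {P} {Q} {A} {T⋆Pair y} {TPair y}
        P≤A (TPair≤ (Q ∨ A) y∈) (T∧≤T⋆ A y∉A) proj₁

    -- The separator is `MPair y` in the minimal case and `MPair x` in the maximal one. In each, an
    -- offending arrow factors through some `b`, which the extremality of `x` identifies with `x`.
    ↝-closed : ∀ {x y} → Θ (T⋆Pair x) (TPair x) → _↝_ 𝓕 x y → Θ (T⋆Pair y) (TPair y)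
    ↝-closed {x} {y} θ (minimal (x↪y , min)) =
      contracts-T (MPair y) T⋆≤My (λ y↛y → y↛y ⟶-refl) y∈ θ
      where
      T⋆≤My : T⋆Pair x ≤ MPair y
      T⋆≤My (x↠z , z≢x) z⟶y with proj₂ mult z⟶y
      ... | b , z↠b , b↪y with dne {b ≡ x} (λ b≢x → min (b , b↪y , b≢x , ↠-trans x↠z z↠b))
      ... | refl = z≢x (TwoAcyclic.↠↠-acyclic acyclic z↠b x↠z)

      y∈ : y ∈ X (TPair x ∨ MPair y)
      y∈ z∈ y⟶z with ⟶↪-acyclic acyclic y⟶z (z∈ (lift false))
      ... | refl = z∈ (lift true) ↠-refl (↪⇒⟶ x↪y)
    ↝-closed {x} {y} θ (maximal (y↠x , max)) =
      contracts-T (MPair x) (T⋆≤M x) (λ y↛x → y↛x (↠⇒⟶ y↠x)) y∈ θ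
      where
      y∈ : y ∈ X (TPair x ∨ MPair x)
      y∈ z∈ y⟶z with proj₂ mult y⟶z
      ... | b , y↠b , b↪z with dne {b ≡ x} (λ b≢x →
              max (b , y↠b , b≢x , ↪-trans b↪z (z∈ (lift false))))
      ... | refl = z∈ (lift true) ↠-refl (↪⇒⟶ b↪z)

    -- Here `P` itself is the separator: a point of `X Q` outside `X P` would be contracted.
    contracted-off : ∀ P Q → Θ P Q → ∀ x → ¬ Θ (T⋆Pair x) (TPair x) → x ∈ X Q → x ∈ X P
    contracted-off P Q θ x ¬θ x∈Q = dne λ x∉P →
      ¬θ (contracts-T {P} {Q} P (λ z∈ → z∈) x∉P (x≤x∨y Q P x∈Q) θ)

    contracts-⋖ : ∀ {u v} → u ⋖ v →
                  (∀ c → c ∈ X v → c ∉ X u → Θ (T⋆Pair c) (TPair c)) → Θ u v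
    contracts-⋖ {u} {v} u⋖v@((u≤v , u≉v) , _) θ
      with ≰⇒∃ v u (λ v≤u → u≉v (≤-antisym u v u≤v v≤u))
    ... | x , x∈v , x∉u with ∉X⇒⟶Y u x∉u
    ... | y , y∈u , x⟶y with proj₂ mult x⟶y
    ... | c , x↠c , c↪y =
      -- The polynomial is `(v ∧ (t ∨ u)) ∨ u`: it sends `T⋆Pair c` to `u` and `TPair c` to `v`.
      congruence-transfer isCongruence {T⋆Pair c} {TPair c} {u} {u} {v}
        (⋖⇒T⋆≤ {u} {v} u⋖v c∈v c∈Yu) (⋖⇒≤T∨ {u} {v} u⋖v c∈v c∈Yu)
        (x∧y≤y v u) u≤v (θ c c∈v λ c∈u → X∩Y⇒↛ u c∈u c∈Yu ⟶-refl)
      where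
      c∈v : c ∈ X v
      c∈v = X-closed v x↠c x∈v

      c∈Yu : c ∈ Y u
      c∈Yu = Y-closed u c↪y y∈u

    contracts-≤ : ∀ P Q → P ≤ Q →
                  (∀ c → c ∈ X Q → c ∉ X P → Θ (T⋆Pair c) (TPair c)) → Θ P Q
    contracts-≤ P Q P≤Q θ = coverDetermined {P} {Q} P≤Q λ {u} {v} u⋖v P≤u v≤Q →
      contracts-⋖ {u} {v} u⋖v λ c c∈v c∉u → θ c (v≤Q c∈v) λ c∈P → c∉u (P≤u c∈P)

    -- Cover-determination concerns comparable pairs only, so `P` and `Q` are each compared with
    -- `P ∧ Q`.
    contracts-off : ∀ P Q →
      (∀ x → ¬ Θ (T⋆Pair x) (TPair x) → x ∈ X P → x ∈ X Q) →
      (∀ x → ¬ Θ (T⋆Pair x) (TPair x) → x ∈ X Q → x ∈ X P) → Θ P Q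
    contracts-off P Q P⊆Q Q⊆P = Θ.trans
      (Θ.sym (contracts-≤ (P ∧ Q) P (x∧y≤x P Q) λ c c∈P c∉ → dne λ ¬θ →
        c∉ (∧-greatest {P} {Q} {TPair c} (TPair≤ P c∈P) (TPair≤ Q (P⊆Q c ¬θ c∈P)) ↠-refl)))
      (contracts-≤ (P ∧ Q) Q (x∧y≤y P Q) λ c c∈Q c∉ → dne λ ¬θ →
        c∉ (∧-greatest {P} {Q} {TPair c} (TPair≤ P (Q⊆P c ¬θ c∈Q)) (TPair≤ Q c∈Q) ↠-refl))

    contracted : Downset 𝓕
    contracted = record
      { members = λ x → Θ (T⋆Pair x) (TPair x)
      ; closed  = ↝-closed
      }

-- The congruence of a downset.

module DownsetCongruence {ℓ} (lem : ExcludedMiddle ℓ) (𝓕 : FactorizationSystem ℓ)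
                         (acyclic : TwoAcyclic 𝓕) (image : ImageCondition 𝓕) where
  open FactorizationSystem 𝓕
  open TPairs lem 𝓕 acyclic
  open PairsProperties lem 𝓕 acyclic
  open MaximalOrthogonalPair
  open CompleteLattice Pairs
  open LatticeProperties Pairs

  module _ (D : Downset 𝓕) where
    open Downset D renaming (members to ⟨D⟩)

    infix 4 _≲_ _∼_

    _≲_ : Rel Carrier ℓ
    P ≲ Q = ∀ x → x ∉ ⟨D⟩ → x ∈ X P → x ∈ X Q

    _∼_ : Rel Carrier ℓ
    P ∼ Q = P ≲ Q × Q ≲ P

    -- The image `m` satisfies `m ↝ y`, so `y ∉ ⟨D⟩` forces `m ∉ ⟨D⟩`. Thus `m` passes from `X P` to
    -- `X Q`, against `m ↪ y`.
    ≲⇒Y : ∀ P Q → P ≲ Q → ∀ y → y ∉ ⟨D⟩ → y ∈ Y Q → y ∈ Y P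
    ≲⇒Y P Q P≲Q y y∉D y∈Q = proj₂ (Y≐X⊥ P) λ x∈P x⟶y →
      let (m , im@((x↠m , m↪y) , _)) , _ = image x⟶y
      in X∩Y⇒↛ Q (P≲Q m (λ m∈D → y∉D (closed m∈D (image⇒↝ im))) (X-closed P x↠m x∈P))
           y∈Q (↪⇒⟶ m↪y)

    Y⇒≲ : ∀ P Q → (∀ y → y ∉ ⟨D⟩ → y ∈ Y Q → y ∈ Y P) → P ≲ Q
    Y⇒≲ P Q Y⊆ x x∉D x∈P = proj₂ (X≐⊥Y Q) λ y∈Q x⟶y →
      let _ , (m , co@((x↠m , m↪y) , _)) = image x⟶y
      in X∩Y⇒↛ P x∈P (Y⊆ m (λ m∈D → x∉D (closed m∈D (coimage⇒↝ co))) (Y-closed Q m↪y y∈Q))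
           (↠⇒⟶ x↠m)

    -- Joins intersect second components, so the comparison is made there and translated back.
    ⋁-mono-≲ : {I : Set ℓ} (f g : I → Carrier) → (∀ i → f i ≲ g i) → ⋁ f ≲ ⋁ g
    ⋁-mono-≲ f g f≲g = Y⇒≲ (⋁ f) (⋁ g) λ y y∉D y∈ i → ≲⇒Y (f i) (g i) (f≲g i) y y∉D (y∈ i)

    ⋀-mono-≲ : {I : Set ℓ} (f g : I → Carrier) → (∀ i → f i ≲ g i) → ⋀ f ≲ ⋀ g
    ⋀-mono-≲ f g f≲g x x∉D x∈ i = f≲g i x x∉D (x∈ i)

    ⋁-cong-∼ : {I : Set ℓ} (f g : I → Carrier) → (∀ i → f i ∼ g i) → ⋁ f ∼ ⋁ g
    ⋁-cong-∼ f g f∼g = ⋁-mono-≲ f g (λ i → proj₁ (f∼g i)) , ⋁-mono-≲ g f (λ i → proj₂ (f∼g i))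

    ⋀-cong-∼ : {I : Set ℓ} (f g : I → Carrier) → (∀ i → f i ∼ g i) → ⋀ f ∼ ⋀ g
    ⋀-cong-∼ f g f∼g = ⋀-mono-≲ f g (λ i → proj₁ (f∼g i)) , ⋀-mono-≲ g f (λ i → proj₂ (f∼g i))

    -- A point of `X Q` outside both `X P` and `D` has an arrow into `Y P`. Its co-image `c` is
    -- again outside `D`, and the cover of `T∨∧M⋖T∨` lies between `P` and `Q` yet differs at `c`.
    ∼-coverDetermined : CoverDetermined Pairs _∼_
    ∼-coverDetermined {P} {Q} P≤Q covers =
      (λ x _ x∈P → P≤Q x∈P) , λ x x∉D x∈Q → dne λ x∉P → absurd x∉D x∈Q x∉P
      where
      absurd : ∀ {x} → x ∉ ⟨D⟩ → x ∈ X Q → ¬ (x ∉ X P)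
      absurd {x} x∉D x∈Q x∉P with ∉X⇒⟶Y P x∉P
      ... | y , y∈P , x⟶y with image x⟶y
      ... | _ , (c , co@((x↠c , c↪y) , _)) =
        x∧y≤y v (MPair c) (proj₂ u∼v c (λ c∈D → x∉D (closed c∈D (coimage⇒↝ co)))
          (x≤x∨y (TPair c) P ↠-refl)) ⟶-refl
        where
        v u : Carrier
        v = TPair c ∨ P
        u = v ∧ MPair c

        c∈YP : c ∈ Y P
        c∈YP = Y-closed P c↪y y∈P

        u∼v : u ∼ v
        u∼v = covers {u} {v} (T∨∧M⋖T∨ P c∈YP)
          (∧-greatest {v} {MPair c} {P} (y≤x∨y (TPair c) P) λ x∈ → X∩Y⇒↛ P x∈ c∈YP)
          (∨-least {TPair c} {P} {Q} (TPair≤ Q (X-closed Q x↠c x∈Q)) P≤Q)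

    congruence : Conᶜᶜ Pairs ℓ
    congruence = record
      { Θ = _∼_
      ; isCongruence = record
        { isEquivalence = record
          { refl  = (λ _ _ p → p) , (λ _ _ p → p)
          ; sym   = λ (a , b) → b , a
          ; trans = λ (a , b) (a′ , b′) →
              (λ x x∉ p → a′ x x∉ (a x x∉ p)) , (λ x x∉ p → b x x∉ (b′ x x∉ p))
          }
        ; respects-≈ = λ ((a , b) , _) → (λ _ _ → a) , (λ _ _ → b)
        ; ∨-cong = λ {x} {x′} {y} {y′} x∼x′ y∼y′ → ⋁-cong-∼ (choose x y) (choose x′ y′)
            λ { (lift true) → x∼x′ ; (lift false) → y∼y′ }
        ; ∧-cong = λ {x} {x′} {y} {y′} x∼x′ y∼y′ → ⋀-cong-∼ (choose x y) (choose x′ y′)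
            λ { (lift true) → x∼x′ ; (lift false) → y∼y′ }
        }
      ; isComplete = record
        { ⋁-cong = λ _ → ⋁-cong-∼
        ; ⋀-cong = λ _ → ⋀-cong-∼
        }
      ; coverDetermined = λ {P} {Q} → ∼-coverDetermined {P} {Q}
      }

    ∈⇒∼ : ∀ {x} → x ∈ ⟨D⟩ → T⋆Pair x ∼ TPair x
    ∈⇒∼ x∈D = (λ _ _ → proj₁) , λ { z z∉D x↠z → x↠z , λ { refl → z∉D x∈D } }

    ∼⇒∈ : ∀ {x} → T⋆Pair x ∼ TPair x → x ∈ ⟨D⟩
    ∼⇒∈ (_ , T≲T⋆) = dne λ x∉D → proj₂ (T≲T⋆ _ x∉D ↠-refl) refl

  congruence-mono : ∀ D E → _≤ᵈ_ 𝓕 D E → _≤ᶜ_ {L = Pairs} (congruence D) (congruence E)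
  congruence-mono D E D⊆E (P≲Q , Q≲P) =
    (λ x x∉E → P≲Q x λ x∈D → x∉E (D⊆E x∈D)) , (λ x x∉E → Q≲P x λ x∈D → x∉E (D⊆E x∈D))

  congruence-cong : ∀ D E → _≈ᵈ_ 𝓕 D E → _≈ᶜ_ {L = Pairs} (congruence D) (congruence E)
  congruence-cong D E (D⊆E , E⊆D) =
    (λ {P} {Q} → congruence-mono D E D⊆E {P} {Q}) ,
    (λ {P} {Q} → congruence-mono E D E⊆D {P} {Q})

  congruence-cancel : ∀ D E → _≤ᶜ_ {L = Pairs} (congruence D) (congruence E) → _≤ᵈ_ 𝓕 D E
  congruence-cancel D E D≤E {x} x∈D = ∼⇒∈ E (D≤E {T⋆Pair x} {TPair x} (∈⇒∼ D x∈D))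

  congruence-contracted : ∀ Φ → _≈ᶜ_ {L = Pairs} (congruence (Contraction.contracted Φ)) Φ
  congruence-contracted Φ =
    (λ {P} {Q} (P≲Q , Q≲P) → contracts-off P Q P≲Q Q≲P) ,
    (λ {P} {Q} θ → contracted-off Q P (Θ.sym θ) , contracted-off P Q θ)
    where open Contraction Φ

  congruence-isOrderIsomorphism :
    IsOrderIsomorphism (_≈ᵈ_ 𝓕) (_≈ᶜ_ {L = Pairs}) (_≤ᵈ_ 𝓕) (_≤ᶜ_ {L = Pairs}) congruence
  congruence-isOrderIsomorphism = record
    { isOrderMonomorphism = record
      { isOrderHomomorphism = record
        { cong = λ {D} {E} D≈E → congruence-cong D E D≈E
        ; mono = λ {D} {E} D≤E {P} {Q} → congruence-mono D E D≤E {P} {Q}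
        }
      ; injective = λ {D} {E} (D≤E , E≤D) →
          congruence-cancel D E (λ {P} {Q} → D≤E {P} {Q}) ,
          congruence-cancel E D (λ {P} {Q} → E≤D {P} {Q})
      ; cancel = λ {D} {E} D≤E → congruence-cancel D E (λ {P} {Q} → D≤E {P} {Q})
      }
    ; surjective = λ Φ → Contraction.contracted Φ , λ {D} D≈ →
        let φD⊆ , φD⊇ = congruence-cong D (Contraction.contracted Φ) D≈
            φ⊆Φ , φ⊇Φ = congruence-contracted Φ
        in (λ {P} {Q} θ → φ⊆Φ {P} {Q} (φD⊆ {P} {Q} θ)) ,
           (λ {P} {Q} θ → φD⊇ {P} {Q} (φ⊇Φ {P} {Q} θ))
    }

  -- Forcing and the transitive closure.

  forces-↝⁺ : ∀ {x y} → TransClosure (_↝_ 𝓕) x y → Forces {L = Pairs} ℓ (TJi x) (TJi y)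
  forces-↝⁺ {x} {y} x↝⁺y Φ {a} {b} a⋖ b⋖ θ = Θ.trans (respects-≈ (T⋆-unique y {b} b⋖))
    (closed⁺ x↝⁺y (Θ.trans (Θ.sym (respects-≈ (T⋆-unique x {a} a⋖))) θ))
    where
    open Contraction Φ
    open Conᶜᶜ Φ
    open IsCongruence isCongruence

    closed⁺ : ∀ {x y} → TransClosure (_↝_ 𝓕) x y → Θ (T⋆Pair x) (TPair x) → Θ (T⋆Pair y) (TPair y)
    closed⁺ [ x↝y ]       θ = ↝-closed θ x↝y
    closed⁺ (x↝z ∷ z↝⁺y) θ = closed⁺ z↝⁺y (↝-closed θ x↝z)

  -- Forcing is tested on one congruence, that of the downset generated by `x`: it contracts at `x`,
  -- hence at `y`, so `y` belongs to that downset.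
  ↝⁺-forces : ∀ {x y} → Forces {L = Pairs} ℓ (TJi x) (TJi y) → TransClosure (_↝_ 𝓕) x y
  ↝⁺-forces {x} {y} forces =
    ∼⇒∈ ↑x (forces (congruence ↑x) {T⋆Pair x} {T⋆Pair y} (T⋆⋖T x) (T⋆⋖T y)
      (∈⇒∼ ↑x [ ↝-refl acyclic ]))
    where
    ↑x : Downset 𝓕
    ↑x = record { members = TransClosure (_↝_ 𝓕) x ; closed = _∷ʳ_ }

  TJi-isOrderIsomorphism :
    IsOrderIsomorphism _≡_ (_≈ʲ_ {L = Pairs}) (TransClosure (_↝_ 𝓕)) (Forces {L = Pairs} ℓ) TJi
  TJi-isOrderIsomorphism = record
    { isOrderMonomorphism = record
      { isOrderHomomorphism = record
        { cong = λ { {x} refl → Poset.Eq.refl pairsPoset {TPair x} }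
        ; mono = forces-↝⁺
        }
      ; injective = TPair-injective
      ; cancel = ↝⁺-forces
      }
    ; surjective = λ (j , irr) → let x , T≈j = TPair-exhausts j irr in x , λ { refl → T≈j }
    }

corollary6p15 : ∀ {ℓ} (lem : ExcludedMiddle ℓ) (𝓕 : FactorizationSystem ℓ) (acyclic : TwoAcyclic 𝓕) → ImageCondition 𝓕 →
    let open FactorizationSystem 𝓕
        open TPairs lem 𝓕 acyclic
    in IsOrderIsomorphism _≡_ (_≈ʲ_ {L = Pairs}) (TransClosure (_↝_ 𝓕)) (Forces {L = Pairs} ℓ) TJi
       × (Σ[ φ ∈ (Downset 𝓕 → Conᶜᶜ Pairs ℓ) ]
            (∀ D x → (x ∈ Downset.members D) ⇔ Contracts (φ D) (T⋆Pair x) (TPair x) (T⋆⋖T x))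
            × IsOrderIsomorphism (_≈ᵈ_ 𝓕) (_≈ᶜ_ {L = Pairs}) (_≤ᵈ_ 𝓕) (_≤ᶜ_ {L = Pairs}) φ)
corollary6p15 lem 𝓕 acyclic image =
  TJi-isOrderIsomorphism ,
  congruence ,
  (λ D x → mk⇔ (∈⇒∼ D) (∼⇒∈ D)) ,
  congruence-isOrderIsomorphism
  where open DownsetCongruence lem 𝓕 acyclic image
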